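{- For $1\le i\le k$ let $G_i$ be an $r_i$-regular graph with $n_i\ge 2$ vertices and let $A_i$ be an Abelian group of order $n_i$. Let $r=\sum_{i=1}^k r_i$ and suppose $\exp(A_i)$ divides $r-r_i$ for every $1\le i\le k$. (a) If each $G_i$ is $A_i$-distance antimagic, then $G_1\Box\cdots\Box G_k$ is $A_1\times\cdots\times A_k$-distance antimagic. (b) If each $G_i$ is $A_i$-distance magic, then $G_1\Box\cdots\Box G_k$ is $A_1\times\cdots\times A_k$-distance magic.
   Context: The Cartesian product $G_1\Box\cdots\Box G_k$ has vertex set $V(G_1)\times\cdots\times V(G_k)$, with $(x_1,\ldots,x_k)$ and $(y_1,\ldots,y_k)$ adjacent iff they differ in exactly one coordinate $i$ and $x_iy_i\in E(G_i)$. $\exp(A)$ is the least positive integer $m$ with $mx=0$ for all $x\in A$. For a graph $G$ with $n$ vertices and an Abelian group $A$ of order $n$ (written additively), and a bijection $f:V(G)\to A$, the weight of $x$ is $w_f(x)=\sum_{y\in N(x)} f(y)$ computed in $A$ ($N(x)$ the open neighbourhood). $f$ is an $A$-distance antimagic labelling if all weights are pairwise distinct, and an $A$-distance magic labelling if all weights are equal. $G$ is $A$-distance antimagic (resp. magic) if it admits such a labelling. -}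

module Defs where

open import Algebra.Bundles using (AbelianGroup)
import Algebra.Definitions.RawMonoid as RawMonoidDefs
open import Data.Fin.Base using (Fin; zero; suc; combine; remQuot)
open import Data.Fin.Properties as Fin
  using (all?; any?; inj⇒≟; combine-remQuot; remQuot-combine)
open import Data.List.Base using (List; allFin; filter; foldr; length; map)
open import Data.Nat.Base
  using (ℕ; zero; suc; _≤_; _<_; +-0-rawMonoid; *-1-rawMonoid)
open import Data.Product.Base using (∃; _×_; _,_; proj₁; proj₂)
open import Function.Base using (_∘_)
open import Function.Bundles using (Bijection; Inverse)
open import Function.Properties.Inverse using (Inverse⇒Injection)
open import Level using (Level; _⊔_) renaming (suc to lsuc)
open import Relation.Binary.Bundles using (Setoid)
open import Relation.Binary.Core using (Rel)
open import Relation.Binary.Definitions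
  using (Decidable; Irreflexive; Symmetric; _Respects₂_)
open import Relation.Binary.PropositionalEquality as ≡
  using (_≡_; _≢_; cong; cong₂)
open import Relation.Nullary.Decidable using (¬?; _×-dec_; _→-dec_)
open import Relation.Nullary.Negation using (¬_)

private
  variable
    a c d ℓ ℓ′ : Level
    k : ℕ

∑ ∏ : (Fin k → ℕ) → ℕ
∑ = RawMonoidDefs.sum +-0-rawMonoid
∏ = RawMonoidDefs.sum *-1-rawMonoid

HasSize : Setoid c ℓ → ℕ → Set (c ⊔ ℓ)
HasSize S n = Inverse S (≡.setoid (Fin n))

-- Finite simple graphs.  The vertices form a setoid because the vertices of
-- a k-fold product are dependent functions on Fin k, compared pointwise.
record Graph (c ℓ a : Level) : Set (lsuc (c ⊔ ℓ ⊔ a)) where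
  field
    vertices    : Setoid c ℓ
    order       : ℕ
    enumeration : HasSize vertices order

  open Setoid vertices public
    using (_≈_) renaming (Carrier to Vertex)

  field
    Adj       : Rel Vertex a
    adj?      : Decidable Adj
    adj-resp  : Adj Respects₂ _≈_
    adj-irr   : Irreflexive _≈_ Adj
    adj-sym   : Symmetric Adj

  _≟_ : Decidable _≈_
  _≟_ = inj⇒≟ (Inverse⇒Injection enumeration)

  neighbours : Vertex → List Vertex
  neighbours x = filter (adj? x) (map (Inverse.from enumeration) (allFin order))

  degree : Vertex → ℕ
  degree x = length (neighbours x)

Regular : Graph c ℓ a → ℕ → Set c
Regular G r = ∀ x → Graph.degree G x ≡ r

HasOrder : AbelianGroup c ℓ → ℕ → Set (c ⊔ ℓ)
HasOrder A = HasSize (AbelianGroup.setoid A)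

Annihilates : ℕ → AbelianGroup c ℓ → Set (c ⊔ ℓ)
Annihilates m A = ∀ x → m · x ≈ ε
  where
  open AbelianGroup A
  open RawMonoidDefs rawMonoid using () renaming (_×_ to _·_)

record IsExponent (A : AbelianGroup c ℓ) (e : ℕ) : Set (c ⊔ ℓ) where
  field
    positive    : 0 < e
    annihilates : Annihilates e A
    least       : ∀ {m} → 0 < m → Annihilates m A → e ≤ m

module _ (G : Graph c ℓ a) (A : AbelianGroup d ℓ′) where
  private
    module G = Graph G
    module A = AbelianGroup A

  Labelling : Set (c ⊔ ℓ ⊔ d ⊔ ℓ′)
  Labelling = Bijection G.vertices A.setoid

  weight : Labelling → G.Vertex → A.Carrier
  weight f x = foldr A._∙_ A.ε (map (Bijection.to f) (G.neighbours x))

  IsDistanceAntimagic : Labelling → Set (c ⊔ ℓ ⊔ ℓ′)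
  IsDistanceAntimagic f =
    ∀ x y → ¬ (x G.≈ y) → ¬ (weight f x A.≈ weight f y)

  IsDistanceMagic : Labelling → Set (c ⊔ ℓ′)
  IsDistanceMagic f = ∀ x y → weight f x A.≈ weight f y

  DistanceAntimagic : Set (c ⊔ ℓ ⊔ d ⊔ ℓ′)
  DistanceAntimagic = ∃ IsDistanceAntimagic

  DistanceMagic : Set (c ⊔ ℓ ⊔ d ⊔ ℓ′)
  DistanceMagic = ∃ IsDistanceMagic

ΠSetoid : (Fin k → Setoid c ℓ) → Setoid c ℓ
ΠSetoid S = record
  { Carrier       = ∀ i → S.Carrier i
  ; _≈_           = λ x y → ∀ i → S._≈_ i (x i) (y i)
  ; isEquivalence = record
    { refl  = λ i → S.refl i
    ; sym   = λ p i → S.sym i (p i)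
    ; trans = λ p q i → S.trans i (p i) (q i)
    }
  }
  where module S i = Setoid (S i)

-- The bijection between Fin n₁ × ⋯ × Fin nₖ and Fin (n₁ ⋯ nₖ).
encode : (n : Fin k → ℕ) → (∀ i → Fin (n i)) → Fin (∏ n)
encode {zero}  n x = zero
encode {suc k} n x = combine (x zero) (encode (n ∘ suc) (x ∘ suc))

decode : (n : Fin k → ℕ) → Fin (∏ n) → ∀ i → Fin (n i)
decode n j zero    = proj₁ (remQuot {n zero} (∏ (n ∘ suc)) j)
decode n j (suc i) =
  decode (n ∘ suc) (proj₂ (remQuot {n zero} (∏ (n ∘ suc)) j)) i

encode-cong : (n : Fin k → ℕ) {x y : ∀ i → Fin (n i)} →
              (∀ i → x i ≡ y i) → encode n x ≡ encode n y
encode-cong {zero}  n p = ≡.refl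
encode-cong {suc k} n p =
  cong₂ combine (p zero) (encode-cong (n ∘ suc) (p ∘ suc))

encode-decode : (n : Fin k → ℕ) (j : Fin (∏ n)) → encode n (decode n j) ≡ j
encode-decode {zero}  n zero = ≡.refl
encode-decode {suc k} n j    = ≡.trans
  (cong (combine (decode n j zero)) (encode-decode (n ∘ suc) _))
  (combine-remQuot {n zero} (∏ (n ∘ suc)) j)

decode-encode : (n : Fin k → ℕ) (x : ∀ i → Fin (n i)) →
                ∀ i → decode n (encode n x) i ≡ x i
decode-encode n x zero =
  cong proj₁ (remQuot-combine (x zero) (encode (n ∘ suc) (x ∘ suc)))
decode-encode n x (suc i) = ≡.trans
  (cong (λ j → decode (n ∘ suc) (proj₂ j) i)
    (remQuot-combine (x zero) (encode (n ∘ suc) (x ∘ suc))))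
  (decode-encode (n ∘ suc) (x ∘ suc) i)

Π-hasSize : (S : Fin k → Setoid c ℓ) (n : Fin k → ℕ) →
            (∀ i → HasSize (S i) (n i)) → HasSize (ΠSetoid S) (∏ n)
Π-hasSize S n enum = record
  { to        = λ x → encode n (λ i → E.to i (x i))
  ; from      = λ j i → E.from i (decode n j i)
  ; to-cong   = λ p → encode-cong n (λ i → E.to-cong i (p i))
  ; from-cong = λ p i → E.from-cong i (cong (λ j → decode n j i) p)
  ; inverse   =
      (λ {j} p → ≡.trans
        (encode-cong n (λ i → E.inverseˡ i (p i)))
        (encode-decode n j))
    , (λ {x} p i → E.inverseʳ i (≡.trans
        (cong (λ j → decode n j i) p)
        (decode-encode n (λ i → E.to i (x i)) i)))
  }
  where module E i = Inverse (enum i)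

-- The Cartesian product G₁ □ ⋯ □ Gₖ.
□ : (Fin k → Graph c ℓ a) → Graph c ℓ (ℓ ⊔ a)
□ {k = k} {ℓ = ℓ} {a = a} G = record
  { vertices    = ΠSetoid G.vertices
  ; order       = ∏ G.order
  ; enumeration = Π-hasSize G.vertices G.order G.enumeration
  ; Adj         = Adj□
  ; adj?        = λ x y → any? λ i →
      ¬? (G._≟_ i (x i) (y i)) ×-dec
      all? (λ j → ¬? (j Fin.≟ i) →-dec G._≟_ j (x j) (y j)) ×-dec
      G.adj? i (x i) (y i)
  ; adj-resp    =
      (λ { p (i , x≉y , eq , e) →
           i
         , (λ q → x≉y (V.trans i q (V.sym i (p i))))
         , (λ j j≢i → V.trans j (eq j j≢i) (p j))
         , proj₁ (G.adj-resp i) (p i) e })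
    , (λ { p (i , x≉y , eq , e) →
           i
         , (λ q → x≉y (V.trans i (p i) q))
         , (λ j j≢i → V.trans j (V.sym j (p j)) (eq j j≢i))
         , proj₂ (G.adj-resp i) (p i) e })
  ; adj-irr     = λ { p (i , x≉y , _) → x≉y (p i) }
  ; adj-sym     = λ { (i , x≉y , eq , e) →
        i
      , (λ q → x≉y (V.sym i q))
      , (λ j j≢i → V.sym j (eq j j≢i))
      , G.adj-sym i e }
  }
  where
  module G i = Graph (G i)
  module V i = Setoid (G.vertices i)

  Adj□ : Rel (∀ i → G.Vertex i) (ℓ ⊔ a)
  Adj□ x y = ∃ λ i →
    ¬ (G._≈_ i (x i) (y i)) ×
    (∀ j → j ≢ i → G._≈_ j (x j) (y j)) ×
    G.Adj i (x i) (y i)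

ΠAbelianGroup : (Fin k → AbelianGroup c ℓ) → AbelianGroup c ℓ
ΠAbelianGroup A = record
  { Carrier        = ∀ i → A.Carrier i
  ; _≈_            = λ x y → ∀ i → A._≈_ i (x i) (y i)
  ; _∙_            = λ x y i → A._∙_ i (x i) (y i)
  ; ε              = λ i → A.ε i
  ; _⁻¹            = λ x i → A._⁻¹ i (x i)
  ; isAbelianGroup = record
    { isGroup = record
      { isMonoid = record
        { isSemigroup = record
          { isMagma = record
            { isEquivalence =
                Setoid.isEquivalence (ΠSetoid A.setoid)
            ; ∙-cong = λ p q i → A.∙-cong i (p i) (q i)
            }
          ; assoc = λ x y z i → A.assoc i (x i) (y i) (z i)
          }
        ; identity = (λ x i → A.identityˡ i (x i))
                   , (λ x i → A.identityʳ i (x i))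
        }
      ; inverse = (λ x i → A.inverseˡ i (x i))
                , (λ x i → A.inverseʳ i (x i))
      ; ⁻¹-cong = λ p i → A.⁻¹-cong i (p i)
      }
    ; comm = λ x y i → A.comm i (x i) (y i)
    }
  }
  where module A i = AbelianGroup (A i)

{-# OPTIONS --safe #-}
-- Label the product coordinatewise, y ↦ (fᵢ yᵢ)ᵢ.  The neighbours of x are
-- the tuples obtained by replacing one entry xⱼ by a neighbour of xⱼ, so the
-- i-th coordinate of the weight of x collects w(xᵢ) from the replacements in
-- position i and rⱼ copies of fᵢ xᵢ from those in each position j ≠ i.  The
-- latter add up to (r − rᵢ) fᵢ xᵢ = 0, hence the weight of x is (w(xᵢ))ᵢ.
module Submission where

open import Defs
open import Algebra.Bundles using (AbelianGroup; CommutativeMonoid)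
import Algebra.Definitions.RawMonoid as RawMonoidDefs
import Algebra.Properties.CommutativeMonoid.Sum as CommutativeMonoidSum
import Algebra.Properties.Monoid.Mult as MonoidMult
open import Data.Fin.Base using (Fin; zero; suc; punchIn)
open import Data.Fin.Properties using (punchInᵢ≢i; _≟_)
open import Data.List.Base
  using (List; []; _∷_; _++_; allFin; concat; foldr; length; map; tabulate)
import Data.List.Membership.Setoid as Membership
open import Data.List.Membership.Setoid.Properties
  using (∈-∃++; ∈-concat⁺; ∈-concat⁻; ∈-filter⁺; ∈-filter⁻; ∈-map⁺; ∈-map⁻;
         ∈-resp-≈; All[≉]⇒∉)
open import Data.List.Membership.Propositional.Properties using (∈-allFin)
open import Data.List.Properties using (map-∘; map-cong; map-++)
import Data.List.Relation.Binary.Permutation.Setoid as Permutation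
import Data.List.Relation.Binary.Permutation.Setoid.Properties as Permutationₚ
import Data.List.Relation.Unary.All.Properties as All
import Data.List.Relation.Unary.AllPairs.Properties as AllPairs
open import Data.List.Relation.Unary.AllPairs using ([]; _∷_)
open import Data.List.Relation.Unary.Any using (here; there)
import Data.List.Relation.Unary.Any.Properties as Any
import Data.List.Relation.Unary.Unique.Propositional.Properties as Uniqueₚ
import Data.List.Relation.Unary.Unique.Setoid as Unique
open import Data.List.Relation.Unary.Unique.Setoid.Properties
  using (concat⁺; filter⁺; map⁺)
open import Data.Nat.Base using (ℕ; zero; suc; _∸_; _≤_; _*_)
open import Data.Nat.Divisibility using (_∣_; divides)
open import Data.Nat.Properties using (+-0-commutativeMonoid; m+n∸m≡n)
open import Data.Product.Base using (_×_; _,_; proj₁; proj₂)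
open import Data.Vec.Functional using (removeAt)
open import Function.Base using (_∘_)
open import Function.Bundles using (Bijection; Inverse)
open import Level using (Level)
open import Relation.Binary.Bundles using (Setoid)
open import Relation.Binary.PropositionalEquality as ≡
  using (_≡_; _≢_; cong; refl)
import Relation.Binary.Reasoning.Setoid as ≈-Reasoning
open import Relation.Nullary.Decidable using (yes; no; decidable-stable)
open import Relation.Nullary.Negation using (contradiction)

private
  variable
    c ℓ a d ℓ′ p : Level
    k : ℕ

-- Duplicate-free lists up to permutation.

module _ (S : Setoid c ℓ) where
  open Setoid S using (sym) renaming (refl to ≈-refl)
  open Membership S using (_∈_)
  open Permutation S using (_↭_; ↭-refl; ↭-sym; ↭-trans; ↭-prep; ↭-reflexive-≋)
  open Permutationₚ S using (shift; ∈-resp-↭; Unique-resp-↭)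
  open Unique S using (Unique)

  -- Induction on `xs`: the head `x` occurs in `ys` up to `≈`, so it can be moved to the front
  -- there. Neither remainder contains `x` again, hence the remainders still have the same members.
  unique∧sameMembers⇒↭ : ∀ {xs ys} → Unique xs → Unique ys →
    (∀ {v} → v ∈ xs → v ∈ ys) → (∀ {v} → v ∈ ys → v ∈ xs) → xs ↭ ys
  unique∧sameMembers⇒↭ {[]} {[]}    _ _ _ _ = ↭-refl
  unique∧sameMembers⇒↭ {[]} {_ ∷ _} _ _ _ ys⊆xs with () ← ys⊆xs (here ≈-refl)
  unique∧sameMembers⇒↭ {x ∷ xs} {ys} (x∉xs ∷ xs!) ys! xs⊆ys ys⊆xs
    with ps , qs , w , x≈w , ys≋ ← ∈-∃++ S (xs⊆ys (here ≈-refl))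
    = ↭-trans (↭-prep x (unique∧sameMembers⇒↭ xs! (Unique.tail S zs!) xs⊆zs zs⊆xs))
              (↭-sym ys↭)
    where
    zs = ps ++ qs

    ys↭ : ys ↭ x ∷ zs
    ys↭ = ↭-trans (↭-reflexive-≋ ys≋) (shift (sym x≈w) ps qs)

    zs! : Unique (x ∷ zs)
    zs! = Unique-resp-↭ ys↭ ys!

    xs⊆zs : ∀ {v} → v ∈ xs → v ∈ zs
    xs⊆zs v∈xs with ∈-resp-↭ ys↭ (xs⊆ys (there v∈xs))
    ... | here v≈x   = contradiction (∈-resp-≈ S v≈x v∈xs) (All[≉]⇒∉ S x∉xs)
    ... | there v∈zs = v∈zs

    zs⊆xs : ∀ {v} → v ∈ zs → v ∈ xs
    zs⊆xs v∈zs with ys⊆xs (∈-resp-↭ (↭-sym ys↭) (there v∈zs))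
    ... | here v≈x   = contradiction (∈-resp-≈ S v≈x v∈zs)
                         (All[≉]⇒∉ S (Unique.head S zs!))
    ... | there v∈xs = v∈xs

-- Sums and multiples in a commutative monoid.

module _ (M : CommutativeMonoid c ℓ) where
  open CommutativeMonoid M renaming (refl to ≈-refl)
  open CommutativeMonoidSum M using (sum; sum-remove; sum-cong-≋)
  open MonoidMult monoid using (×-homo-+; ×-congˡ) renaming (_×_ to _·_)
  open ≈-Reasoning setoid
  private module ℕ-Sum = CommutativeMonoidSum +-0-commutativeMonoid

  sum-· : (r : Fin k → ℕ) (x : Carrier) → sum (λ j → r j · x) ≈ ∑ r · x
  sum-· {zero}  r x = ≈-refl
  sum-· {suc k} r x = begin
    r zero · x ∙ sum (λ j → r (suc j) · x) ≈⟨ ∙-congˡ (sum-· (r ∘ suc) x) ⟩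
    r zero · x ∙ ∑ (r ∘ suc) · x           ≈⟨ ×-homo-+ x (r zero) (∑ (r ∘ suc)) ⟨
    ∑ r · x                                ∎

  -- The truncated subtraction is exact, because `r i` is one of the summands of `∑ r`.
  ∑-removeAt : (r : Fin (suc k) → ℕ) (i : Fin (suc k)) →
               ∑ (removeAt r i) ≡ ∑ r ∸ r i
  ∑-removeAt r i = ≡.sym (≡.trans (cong (_∸ r i) (ℕ-Sum.sum-remove {i = i} r))
                                  (m+n∸m≡n (r i) _))

  -- Once the term at `i` is split off, the remaining indices are the `punchIn i j`, all different
  -- from `i`. This isolates the multiple of `x` that the exponent hypothesis makes vanish.
  sum-multiplesExceptAt : (t : Fin k → Carrier) (r : Fin k → ℕ) (x : Carrier)
    (i : Fin k) → (∀ j → j ≢ i → t j ≈ r j · x) →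
    sum t ≈ t i ∙ (∑ r ∸ r i) · x
  sum-multiplesExceptAt {suc k} t r x i t≈ = begin
    sum t                                ≈⟨ sum-remove t ⟩
    t i ∙ sum (removeAt t i)             ≈⟨ ∙-congˡ (sum-cong-≋ λ j →
                                              t≈ (punchIn i j) (punchInᵢ≢i i j)) ⟩
    t i ∙ sum (λ j → removeAt r i j · x) ≈⟨ ∙-congˡ (sum-· (removeAt r i) x) ⟩
    t i ∙ ∑ (removeAt r i) · x           ≈⟨ ∙-congˡ (×-congˡ (∑-removeAt r i)) ⟩
    t i ∙ (∑ r ∸ r i) · x                ∎

  foldr-++ : ∀ xs ys → foldr _∙_ ε (xs ++ ys) ≈ foldr _∙_ ε xs ∙ foldr _∙_ ε ys
  foldr-++ []       ys = sym (identityˡ _)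
  foldr-++ (x ∷ xs) ys = trans (∙-congˡ (foldr-++ xs ys)) (sym (assoc _ _ _))

  foldr-map-concat-tabulate : {B : Set d} (g : B → Carrier) (L : Fin k → List B) →
    foldr _∙_ ε (map g (concat (tabulate L))) ≈
    sum (λ j → foldr _∙_ ε (map g (L j)))
  foldr-map-concat-tabulate {k = zero}  g L = ≈-refl
  foldr-map-concat-tabulate {k = suc k} g L = begin
    foldr _∙_ ε (map g (L zero ++ rest))
      ≡⟨ cong (foldr _∙_ ε) (map-++ g (L zero) rest) ⟩
    foldr _∙_ ε (map g (L zero) ++ map g rest)
      ≈⟨ foldr-++ (map g (L zero)) (map g rest) ⟩
    foldr _∙_ ε (map g (L zero)) ∙ foldr _∙_ ε (map g rest)
      ≈⟨ ∙-congˡ (foldr-map-concat-tabulate g (L ∘ suc)) ⟩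
    sum (λ j → foldr _∙_ ε (map g (L j)))
      ∎
    where rest = concat (tabulate (L ∘ suc))

  -- Both sides unfold to the same iteration of `x ∙_` on `ε`, so the equality is propositional.
  foldr-map-const : {B : Set d} (x : Carrier) (xs : List B) →
                    foldr _∙_ ε (map (λ _ → x) xs) ≡ length xs · x
  foldr-map-const x []       = refl
  foldr-map-const x (_ ∷ xs) = cong (x ∙_) (foldr-map-const x xs)

-- Replacing one entry of a dependent tuple.

-- Recursion on both indices, instead of a test `j ≟ i`, avoids transporting `v : P i` along an
-- equality of indices.
_[_]≔_ : {P : Fin k → Set p} → (∀ j → P j) → ∀ i → P i → ∀ j → P j
(x [ zero  ]≔ v) zero    = v
(x [ zero  ]≔ v) (suc j) = x (suc j)
(x [ suc i ]≔ v) zero    = x zero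
(x [ suc i ]≔ v) (suc j) = ((x ∘ suc) [ i ]≔ v) j

update-≡ : {P : Fin k → Set p} (x : ∀ j → P j) (i : Fin k) (v : P i) →
           (x [ i ]≔ v) i ≡ v
update-≡ x zero    v = refl
update-≡ x (suc i) v = update-≡ (x ∘ suc) i v

update-≢ : {P : Fin k → Set p} (x : ∀ j → P j) (i : Fin k) (v : P i) →
           ∀ j → j ≢ i → (x [ i ]≔ v) j ≡ x j
update-≢ x zero    v zero    j≢i = contradiction refl j≢i
update-≢ x zero    v (suc j) j≢i = refl
update-≢ x (suc i) v zero    j≢i = refl
update-≢ x (suc i) v (suc j) j≢i = update-≢ (x ∘ suc) i v j (j≢i ∘ cong suc)

-- Neighbour lists of a single graph.

module _ (G : Graph c ℓ a) where
  open Graph G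
  open Membership vertices using (_∈_)
  private
    module V = Setoid vertices
    module E = Inverse enumeration

  -- Every vertex `y` is, up to `≈`, the vertex enumerated at the index `E.to y`, so it survives the
  -- filter up to `≈`.
  ∈-neighbours⁺ : ∀ {x y} → Adj x y → y ∈ neighbours x
  ∈-neighbours⁺ {x} {y} = ∈-filter⁺ vertices (adj? x) (proj₁ adj-resp)
    (∈-resp-≈ vertices (E.strictlyInverseʳ y)
      (∈-map⁺ (≡.setoid _) vertices E.from-cong (∈-allFin (E.to y))))

  ∈-neighbours⁻ : ∀ {x y} → y ∈ neighbours x → Adj x y
  ∈-neighbours⁻ {x} y∈ = proj₂ (∈-filter⁻ vertices (adj? x) (proj₁ adj-resp)
    {xs = map E.from (allFin order)} y∈)

  neighbours-unique : ∀ x → Unique.Unique vertices (neighbours x)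
  neighbours-unique x = filter⁺ vertices (adj? x)
    (map⁺ (≡.setoid _) vertices from-injective (Uniqueₚ.allFin⁺ order))
    where
    from-injective : ∀ {i j} → E.from i V.≈ E.from j → i ≡ j
    from-injective {i} {j} eq = ≡.trans (≡.sym (E.strictlyInverseˡ i))
      (≡.trans (E.to-cong eq) (E.strictlyInverseˡ j))

-- Neighbour lists of the Cartesian product.

module _ (G : Fin k → Graph c ℓ a) where
  private
    module G i = Graph (G i)
    module V i = Setoid (G.vertices i)
    module □G = Graph (□ G)

  open Membership □G.vertices using (_∈_)

  neighboursAt : □G.Vertex → Fin k → List □G.Vertex
  neighboursAt x i = map (x [ i ]≔_) (G.neighbours i (x i))

  update-cong : ∀ x i {v w} → G._≈_ i v w → (x [ i ]≔ v) □G.≈ (x [ i ]≔ w)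
  update-cong x i {v} {w} v≈w j with j ≟ i
  ... | yes refl = V.trans i (V.reflexive i (update-≡ x i v))
                     (V.trans i v≈w (V.reflexive i (≡.sym (update-≡ x i w))))
  ... | no j≢i   = V.reflexive j
                     (≡.trans (update-≢ x i v j j≢i) (≡.sym (update-≢ x i w j j≢i)))

  -- Reading position `i` recovers the new entry. This keeps each block `neighboursAt x i` free of
  -- duplicates.
  update-injective : ∀ x i {v w} → (x [ i ]≔ v) □G.≈ (x [ i ]≔ w) → G._≈_ i v w
  update-injective x i {v} {w} eq = V.trans i
    (V.reflexive i (≡.sym (update-≡ x i v)))
    (V.trans i (eq i) (V.reflexive i (update-≡ x i w)))

  -- The entry to insert is `y i` itself; the resulting tuple agrees with `y` only pointwise up to
  -- `≈`.
  ∈-neighboursAt⁺ : ∀ {x y i} → (∀ j → j ≢ i → G._≈_ j (x j) (y j)) →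
                    G.Adj i (x i) (y i) → y ∈ neighboursAt x i
  ∈-neighboursAt⁺ {x} {y} {i} eq adj = ∈-resp-≈ □G.vertices x[i]≔yᵢ≈y
    (∈-map⁺ (G.vertices i) □G.vertices (update-cong x i) (∈-neighbours⁺ (G i) adj))
    where
    x[i]≔yᵢ≈y : (x [ i ]≔ y i) □G.≈ y
    x[i]≔yᵢ≈y j with j ≟ i
    ... | yes refl = V.reflexive i (update-≡ x i (y i))
    ... | no j≢i   = V.trans j (V.reflexive j (update-≢ x i (y i) j j≢i)) (eq j j≢i)

  ∈-neighboursAt⁻ : ∀ {x y i} → y ∈ neighboursAt x i →
                    (∀ j → j ≢ i → G._≈_ j (x j) (y j)) × G.Adj i (x i) (y i)
  ∈-neighboursAt⁻ {x} {y} {i} y∈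
    with v , v∈ , y≈ ← ∈-map⁻ (G.vertices i) □G.vertices y∈
    = (λ j j≢i → V.sym j (V.trans j (y≈ j) (V.reflexive j (update-≢ x i v j j≢i))))
    , proj₁ (G.adj-resp i)
        (V.sym i (V.trans i (y≈ i) (V.reflexive i (update-≡ x i v))))
        (∈-neighbours⁻ (G i) v∈)

  -- The two lists are built in different orders, so they are compared through uniqueness and
  -- membership.
  neighbours-□ : ∀ x → let open Permutation □G.vertices in
                 □G.neighbours x ↭ concat (tabulate (neighboursAt x))
  neighbours-□ x = unique∧sameMembers⇒↭ □G.vertices
    (neighbours-unique (□ G) x)
    (concat⁺ □G.vertices
      (All.tabulate⁺ λ i → map⁺ (G.vertices i) □G.vertices
        (update-injective x i) (neighbours-unique (G i) (x i)))
      -- Different blocks are disjoint: a common `y` would agree with `x` at `i`, being in block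
      -- `j`, and be adjacent to `x` at `i`, being in block `i`.
      (AllPairs.tabulate⁺ λ {i} {j} i≢j (y∈i , y∈j) →
        G.adj-irr i (proj₁ (∈-neighboursAt⁻ y∈j) i i≢j)
                    (proj₂ (∈-neighboursAt⁻ y∈i))))
    (λ y∈ → let i , _ , eq , adj = ∈-neighbours⁻ (□ G) {x} y∈ in
      ∈-concat⁺ □G.vertices (Any.tabulate⁺ i (∈-neighboursAt⁺ eq adj)))
    (λ y∈ →
      let i , y∈i  = Any.tabulate⁻ (∈-concat⁻ □G.vertices (tabulate (neighboursAt x)) y∈)
          eq , adj = ∈-neighboursAt⁻ y∈i
      in ∈-neighbours⁺ (□ G)
           -- That the entries at `i` differ follows from irreflexivity of adjacency.
           (i , (λ xᵢ≈yᵢ → G.adj-irr i xᵢ≈yᵢ adj) , eq , adj))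

-- The coordinatewise labelling and its weights.

module _ (G : Fin k → Graph c ℓ a) (A : Fin k → AbelianGroup d ℓ′)
         (f : ∀ i → Labelling (G i) (A i)) where
  private
    module G i = Graph (G i)
    module A i = AbelianGroup (A i)
    module F i = Bijection (f i)
    module □G = Graph (□ G)

  Π-labelling : Labelling (□ G) (ΠAbelianGroup A)
  Π-labelling = record
    { to        = λ x i → F.to i (x i)
    ; cong      = λ p i → F.cong i (p i)
    ; bijective = (λ p i → F.injective i (p i))
                , λ y → (λ i → proj₁ (F.surjective i (y i)))
                      , λ p i → proj₂ (F.surjective i (y i)) (p i)
    }

  module _ (r : Fin k → ℕ) (regular : ∀ i → Regular (G i) (r i))
           (annihilates : ∀ i → Annihilates (∑ r ∸ r i) (A i)) where

    weight-Π : ∀ x i →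
      A._≈_ i (weight (□ G) (ΠAbelianGroup A) Π-labelling x i)
              (weight (G i) (A i) (f i) (x i))
    weight-Π x i = begin
      weight (□ G) (ΠAbelianGroup A) Π-labelling x i
        ≡⟨ foldr-at (□G.neighbours x) ⟩
      foldr _∙_ ε (map g (□G.neighbours x))
        -- Commutativity allows the neighbours to be regrouped by the position in which they differ
        -- from `x`.
        ≈⟨ Permutationₚ.foldr-commMonoid setoid isCommutativeMonoid
             (Permutationₚ.map⁺ □G.vertices setoid (λ p → F.cong i (p i))
               (neighbours-□ G x)) ⟩
      foldr _∙_ ε (map g (concat (tabulate (neighboursAt G x))))
        ≈⟨ foldr-map-concat-tabulate commutativeMonoid g (neighboursAt G x) ⟩
      sum contribution
        ≈⟨ sum-multiplesExceptAt commutativeMonoid contribution r (g x) i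
             contribution-≢ ⟩
      contribution i ∙ (∑ r ∸ r i) · g x
        ≈⟨ ∙-congˡ (annihilates i (g x)) ⟩
      contribution i ∙ ε
        ≈⟨ identityʳ (contribution i) ⟩
      contribution i
        ≡⟨ contribution-≡ ⟩
      weight (G i) (A i) (f i) (x i)
        ∎
      where
      open AbelianGroup (A i) hiding (refl)
      open RawMonoidDefs rawMonoid using (sum) renaming (_×_ to _·_)
      open ≈-Reasoning setoid

      g : □G.Vertex → Carrier
      g y = F.to i (y i)

      contribution : Fin k → Carrier
      contribution j = foldr _∙_ ε (map g (neighboursAt G x j))

      -- Evaluation at `i` passes through the fold by computation, since the product group operates
      -- coordinatewise.
      foldr-at : ∀ ys →
        foldr (AbelianGroup._∙_ (ΠAbelianGroup A)) (AbelianGroup.ε (ΠAbelianGroup A))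
          (map (Bijection.to Π-labelling) ys) i ≡ foldr _∙_ ε (map g ys)
      foldr-at []       = refl
      foldr-at (y ∷ ys) = cong (g y ∙_) (foldr-at ys)

      -- Serves both kinds of block: `h` is `F.to i` for `j = i` and the constant `g x` for `j ≢ i`.
      contribution-via : ∀ {j} {h : G.Vertex j → Carrier} →
        (∀ v → g (x [ j ]≔ v) ≡ h v) →
        contribution j ≡ foldr _∙_ ε (map h (G.neighbours j (x j)))
      contribution-via {j} g≗h = cong (foldr _∙_ ε)
        (≡.trans (≡.sym (map-∘ (G.neighbours j (x j))))
                 (map-cong g≗h (G.neighbours j (x j))))

      contribution-≡ : contribution i ≡ weight (G i) (A i) (f i) (x i)
      contribution-≡ = contribution-via λ v → cong (F.to i) (update-≡ x i v)

      contribution-≢ : ∀ j → j ≢ i → contribution j ≈ r j · g x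
      contribution-≢ j j≢i = reflexive (≡.trans
        (contribution-via λ v → cong (F.to i) (update-≢ x j v i (j≢i ∘ ≡.sym)))
        (≡.trans (foldr-map-const commutativeMonoid (g x) (G.neighbours j (x j)))
                 (cong (_· g x) (regular j (x j)))))

-- From exponents to antimagic and magic products.

annihilates-∣ : (A : AbelianGroup c ℓ) {e m : ℕ} → e ∣ m →
                Annihilates e A → Annihilates m A
annihilates-∣ A {e} (divides q refl) e·≈ε x = begin
  (q * e) · x ≈⟨ ×-assocˡ x q e ⟨
  q · (e · x) ≈⟨ ×-congʳ q (e·≈ε x) ⟩
  q · ε       ≈⟨ q·ε≈ε q ⟩
  ε           ∎
  where
  open AbelianGroup A
  open MonoidMult monoid using (×-assocˡ; ×-congʳ) renaming (_×_ to _·_)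
  open ≈-Reasoning setoid

  q·ε≈ε : ∀ q → q · ε ≈ ε
  q·ε≈ε zero    = AbelianGroup.refl A
  q·ε≈ε (suc q) = trans (identityˡ _) (q·ε≈ε q)

mainTheorem6 : ∀ {c ℓ a d ℓ′} (k : ℕ)
    (G : Fin k → Graph c ℓ a) (A : Fin k → AbelianGroup d ℓ′)
    (n r e : Fin k → ℕ) →
    (∀ i → Graph.order (G i) ≡ n i) →
    (∀ i → 2 ≤ n i) →
    (∀ i → Regular (G i) (r i)) →
    (∀ i → HasOrder (A i) (n i)) →
    (∀ i → IsExponent (A i) (e i)) →
    (∀ i → e i ∣ ∑ r ∸ r i) →
    ((∀ i → DistanceAntimagic (G i) (A i)) → DistanceAntimagic (□ G) (ΠAbelianGroup A)) ×
    ((∀ i → DistanceMagic (G i) (A i)) → DistanceMagic (□ G) (ΠAbelianGroup A))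
mainTheorem6 k G A n r e _ _ regular _ exponent e∣ = antimagic , magic
  where
  module A i = AbelianGroup (A i)

  weight-product : (f : ∀ i → Labelling (G i) (A i)) → ∀ x i →
    A._≈_ i (weight (□ G) (ΠAbelianGroup A) (Π-labelling G A f) x i)
            (weight (G i) (A i) (f i) (x i))
  weight-product f = weight-Π G A f r regular λ i →
    annihilates-∣ (A i) (e∣ i) (IsExponent.annihilates (exponent i))

  antimagic : (∀ i → DistanceAntimagic (G i) (A i)) →
              DistanceAntimagic (□ G) (ΠAbelianGroup A)
  antimagic h = Π-labelling G A f , λ x y x≉y wx≈wy → x≉y λ i →
    -- Antimagic labellings only refute equal weights at distinct vertices; decidable vertex
    -- equality turns the resulting double negation into `x i ≈ y i`.
    decidable-stable (Graph._≟_ (G i) (x i) (y i)) λ xᵢ≉yᵢ →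
      proj₂ (h i) (x i) (y i) xᵢ≉yᵢ
        (A.trans i (A.sym i (weight-product f x i))
          (A.trans i (wx≈wy i) (weight-product f y i)))
    where f = λ i → proj₁ (h i)

  magic : (∀ i → DistanceMagic (G i) (A i)) →
          DistanceMagic (□ G) (ΠAbelianGroup A)
  magic h = Π-labelling G A f , λ x y i →
    A.trans i (weight-product f x i)
      (A.trans i (proj₂ (h i) (x i) (y i)) (A.sym i (weight-product f y i)))
    where f = λ i → proj₁ (h i)
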